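{- Let $u\ge \ell\ge 1$ and $m\ge 1$ be integers with $m\le 2^u$, let $n\coloneqq 2^\ell$, and let $\mathcal{H}$ be the set of all linear maps $\mathbb{F}_2^u\to\mathbb{F}_2^\ell$. For any $S\subseteq \mathbb{F}_2^u$ of cardinality $m$, if $h$ is drawn uniformly at random from $\mathcal{H}$, then \[\mathbb{E}_{h\sim \mathcal{H}}\left[\max_{y\in \mathbb{F}_2^\ell} |h^{ -1}(y)\cap S|\right] \le 16\cdot \textsc{opt}(m,n).\]
   Context: $\log$ denotes the base-2 logarithm. For positive integers $m,n$ define \[\textsc{opt}(m,n) = \begin{cases}\dfrac{\log n}{\log\left(\frac{n\log n}{m}\right)} & m\le \frac{1}{2}n\log n, \\[2mm] \dfrac{m}{n} & m > \frac{1}{2} n\log n.\end{cases}\] -}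

module Defs where

open import Data.Bool using (Bool; true; false; _∧_; _xor_)
open import Data.Bool.Properties using () renaming (_≟_ to _≟ᵇ_)
open import Data.Nat using (ℕ; zero; suc; _+_; _*_; _^_; _≤_; _<_; _⊔_)
open import Data.List using (List; []; _∷_; map; concatMap; foldr; filter; length)
open import Data.Nat.ListAction using (sum)
open import Data.Vec using (Vec; []; _∷_; zipWith)
import Data.Vec as Vec
open import Data.Vec.Properties using (≡-dec)
open import Data.Product using (_×_)
open import Relation.Binary.PropositionalEquality using (_≡_)
open import Relation.Nullary using (Dec)

-- Vectors of F₂^k are represented as Vec Bool k (xor = addition, ∧ = multiplication).
F₂^ : ℕ → Set
F₂^ k = Vec Bool k

_≟v_ : ∀ {k} (x y : F₂^ k) → Dec (x ≡ y)
_≟v_ = ≡-dec _≟ᵇ_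

allVecsOf : ∀ {A : Set} → List A → (k : ℕ) → List (Vec A k)
allVecsOf xs zero = [] ∷ []
allVecsOf xs (suc k) = concatMap (λ a → map (a ∷_) (allVecsOf xs k)) xs

allF₂^ : (k : ℕ) → List (F₂^ k)
allF₂^ = allVecsOf (false ∷ true ∷ [])

-- A linear map F₂^u → F₂^ℓ is given by its ℓ×u matrix (list of ℓ rows).
LinMap : ℕ → ℕ → Set
LinMap u ℓ = Vec (F₂^ u) ℓ

dot : ∀ {u} → F₂^ u → F₂^ u → Bool
dot r x = Vec.foldr _ _xor_ false (zipWith _∧_ r x)

apply : ∀ {u ℓ} → LinMap u ℓ → F₂^ u → F₂^ ℓ
apply M x = Vec.map (λ r → dot r x) M

ℋ : (u ℓ : ℕ) → List (LinMap u ℓ)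
ℋ u ℓ = allVecsOf (allF₂^ u) ℓ

preimageCount : ∀ {u ℓ} → LinMap u ℓ → List (F₂^ u) → F₂^ ℓ → ℕ
preimageCount h S y = length (filter (λ x → apply h x ≟v y) S)

maxLoad : ∀ {u ℓ} → LinMap u ℓ → List (F₂^ u) → ℕ
maxLoad {u} {ℓ} h S = foldr _⊔_ 0 (map (preimageCount h S) (allF₂^ ℓ))

-- Σ_{h ∈ ℋ} maxLoad h S ;  the expectation is this divided by |ℋ|
totalMaxLoad : (u ℓ : ℕ) → List (F₂^ u) → ℕ
totalMaxLoad u ℓ S = sum (map (λ h → maxLoad h S) (ℋ u ℓ))

-- "A / N ≤ 16 · opt(m, 2^ℓ)", with log n = ℓ, cleared of reals exactly:
--  * case m ≤ ½ n log n  (i.e. 2m ≤ ℓ·2^ℓ):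
--      A/N ≤ 16 ℓ / log₂(ℓ 2^ℓ / m)
--      ⇔ A · log₂(ℓ2^ℓ/m) ≤ 16 ℓ N     (log > 0 here)
--      ⇔ (ℓ2^ℓ/m)^A ≤ 2^(16 ℓ N)
--      ⇔ (ℓ·2^ℓ)^A ≤ m^A · 2^(16 ℓ N)
--  * case m > ½ n log n:  A/N ≤ 16 m / 2^ℓ  ⇔  A · 2^ℓ ≤ 16 · m · N
AvgLe16Opt : (m ℓ A N : ℕ) → Set
AvgLe16Opt m ℓ A N =
  (2 * m ≤ ℓ * 2 ^ ℓ → (ℓ * 2 ^ ℓ) ^ A ≤ m ^ A * 2 ^ (16 * ℓ * N))
  × (ℓ * 2 ^ ℓ < 2 * m → A * 2 ^ ℓ ≤ 16 * m * N)

{-# OPTIONS --safe #-}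

-- Let W(h, S) = Σ_y λ^|h⁻¹(y) ∩ S|, and reveal the columns of h one at a time. If c is the first
-- column, h′ the rest, and S₀, S₁ ⊆ F₂^(u-1) are the points of S with first bit 0, 1, then the load of
-- y is the load of y from S₀ plus the load of y ⊕ c from S₁ (both under h′), so
-- Σ_c W((c, h′), S) = W(h′, S₀) W(h′, S₁). By AM-GM (i.e. Jensen for log) E log(W / n) is thus
-- subadditive over the split, and splitting S into single points gives
-- E log W ≤ log n + m log(1 + (λ - 1) / n). As λ^maxload ≤ W, the choices λ = n log n / m and λ = 2
-- give the two cases. Everything is exponentiated, with λ = p / q, to stay in ℕ.

module Submission where

open import Defs
open import Algebra.Bundles using (CommutativeSemigroup)
open import Algebra.Structures using (IsCommutativeMonoid)
open import Data.Bool using (Bool; true; false; if_then_else_; _xor_)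
open import Data.Bool.Properties using (∧-zeroʳ; ∧-identityʳ)
open import Data.Empty using (⊥-elim)
open import Data.List using (List; []; _∷_; _++_; map; concatMap; foldr; length; replicate)
open import Data.List.Membership.Propositional using (_∈_)
open import Data.List.Properties using (length-++; length-map; length-replicate)
open import Data.List.Relation.Unary.All using (All; []; _∷_)
open import Data.List.Relation.Unary.AllPairs using ([]; _∷_)
open import Data.List.Relation.Unary.Any using (here; there)
open import Data.List.Relation.Unary.Unique.Propositional using (Unique)
open import Data.Nat using (ℕ; zero; suc; _+_; _*_; _^_; _⊔_; _≤_; _<_; NonZero; z≤n; s≤s; >-nonZero)
open import Data.Nat.ListAction using (sum; product)
open import Data.Nat.ListAction.Properties using (sum-++; product-++)
open import Data.Nat.Properties
open import Data.Nat.Tactic.RingSolver using (solve-∀)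
open import Data.Product using (_×_; _,_; ∃-syntax)
open import Data.Sum using (inj₁; inj₂)
open import Data.Vec using ([]; _∷_; zipWith)
open import Function using (_∘_)
open import Level using (0ℓ)
open import Relation.Binary.PropositionalEquality using (_≡_; _≢_; refl; sym; trans; cong; cong₂; module ≡-Reasoning)
open import Relation.Nullary using (yes; no; does)

-- Powers and the AM-GM inequality

^-distribʳ-* : ∀ x y k → (x * y) ^ k ≡ x ^ k * y ^ k
^-distribʳ-* x y zero = refl
^-distribʳ-* x y (suc k) = trans (cong (x * y *_) (^-distribʳ-* x y k)) (shuffle x y (x ^ k) (y ^ k))
  where
  shuffle : ∀ x y a b → x * y * (a * b) ≡ x * a * (y * b)
  shuffle = solve-∀

^-cancelʳ-≤ : ∀ b {m n} → 1 < b → b ^ m ≤ b ^ n → m ≤ n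
^-cancelʳ-≤ b {m} {n} 1<b bᵐ≤bⁿ with ≤-total m n
... | inj₁ m≤n = m≤n
... | inj₂ n≤m with m≤n⇒m<n∨m≡n n≤m
...   | inj₁ n<m = ⊥-elim (<⇒≱ (^-monoʳ-< b 1<b n<m) bᵐ≤bⁿ)
...   | inj₂ n≡m = ≤-reflexive (sym n≡m)

2xy≤x²+y² : ∀ x y → 2 * (x * y) ≤ x * x + y * y
2xy≤x²+y² x y with ≤-total x y
... | inj₁ x≤y with m≤n⇒∃[o]m+o≡n x≤y
...   | d , refl = m+n≤o⇒m≤o (2 * (x * (x + d))) (≤-reflexive (square x d))
  where
  square : ∀ x d → 2 * (x * (x + d)) + d * d ≡ x * x + (x + d) * (x + d)
  square = solve-∀
2xy≤x²+y² x y | inj₂ y≤x with m≤n⇒∃[o]m+o≡n y≤x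
...   | d , refl = m+n≤o⇒m≤o (2 * ((y + d) * y)) (≤-reflexive (square y d))
  where
  square : ∀ y d → 2 * ((y + d) * y) + d * d ≡ (y + d) * (y + d) + y * y
  square = solve-∀

-- Bernoulli's inequality for x / y, cleared of the denominator.
bernoulli : ∀ j x y → suc j * (x * y ^ j) ≤ x ^ suc j + j * y ^ suc j
bernoulli zero x y = ≤-reflexive (base x)
  where
  base : ∀ x → 1 * (x * 1) ≡ x * 1 + 0
  base = solve-∀
-- The induction hypothesis times x is added to `suc j * Y` copies of 2xy ≤ x² + y². The terms that
-- a subtraction would remove are collected in `T`, added to both sides and cancelled.
bernoulli (suc j) x y = +-cancelʳ-≤ T _ _ (begin
  suc (suc j) * (x * (y * Y)) + T
    ≡⟨ lhs j x y Y ⟩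
  x * (suc j * (x * Y)) + suc j * Y * (2 * (x * y))
    ≤⟨ +-mono-≤ (*-monoʳ-≤ x (bernoulli j x y)) (*-monoʳ-≤ (suc j * Y) (2xy≤x²+y² x y)) ⟩
  x * (X + j * (y * Y)) + suc j * Y * (x * x + y * y)
    ≡⟨ rhs j x y X Y ⟩
  x * X + suc j * (y * (y * Y)) + T ∎)
  where
  open ≤-Reasoning
  X = x ^ suc j
  Y = y ^ j
  T = suc j * (x * x * Y) + j * (x * y * Y)
  lhs : ∀ j x y Y → suc (suc j) * (x * (y * Y)) + (suc j * (x * x * Y) + j * (x * y * Y))
                  ≡ x * (suc j * (x * Y)) + suc j * Y * (2 * (x * y))
  lhs = solve-∀
  rhs : ∀ j x y X Y → x * (X + j * (y * Y)) + suc j * Y * (x * x + y * y)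
                    ≡ x * X + suc j * (y * (y * Y)) + (suc j * (x * x * Y) + j * (x * y * Y))
  rhs = solve-∀

-- Bernoulli for the ratio of the means (s + a) / (k + 1) and s / k.
weightedAMGM : ∀ k s a → suc k ^ suc k * (a * s ^ k) ≤ k ^ k * (s + a) ^ suc k
weightedAMGM zero s a = m+n≤o⇒n≤o s (≤-reflexive (base s a))
  where
  base : ∀ s a → s + 1 * (a * 1) ≡ 1 * ((s + a) * 1)
  base = solve-∀
-- Bernoulli at x = k (s + a), y = (k + 1) s. Its term k y^(k+1) is added on the left, and the
-- common factor k is cancelled, hence the separate case k = 0.
weightedAMGM k@(suc _) s a = *-cancelˡ-≤ k (+-cancelʳ-≤ (k * (J * s * (J ^ k * s ^ k))) _ _ (begin
  k * (J ^ J * (a * s ^ k)) + k * (J * s * (J ^ k * s ^ k))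
    ≡⟨ lhs k J s a (J ^ k) (s ^ k) ⟩
  J * (k * (s + a) * (J ^ k * s ^ k))
    ≡⟨ cong (λ t → J * (k * (s + a) * t)) (^-distribʳ-* J s k) ⟨
  J * (k * (s + a) * (J * s) ^ k)
    ≤⟨ bernoulli k (k * (s + a)) (J * s) ⟩
  (k * (s + a)) ^ J + k * (J * s) ^ J
    ≡⟨ cong₂ (λ t v → t + k * (J * s * v)) (^-distribʳ-* k (s + a) J) (^-distribʳ-* J s k) ⟩
  k * k ^ k * (s + a) ^ J + k * (J * s * (J ^ k * s ^ k))
    ≡⟨ cong (_+ k * (J * s * (J ^ k * s ^ k))) (*-assoc k (k ^ k) ((s + a) ^ J)) ⟩
  k * (k ^ k * (s + a) ^ J) + k * (J * s * (J ^ k * s ^ k)) ∎))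
  where
  open ≤-Reasoning
  J = suc k
  lhs : ∀ k J s a A B → k * (J * A * (a * B)) + k * (J * s * (A * B)) ≡ J * (k * (s + a) * (A * B))
  lhs = solve-∀

-- Since 0 ^ 0 = 1, `AMGM` may cancel `k ^ k` even when the tail is empty.
n^n≢0 : ∀ n → NonZero (n ^ n)
n^n≢0 zero = _
n^n≢0 (suc n) = m^n≢0 (suc n) (suc n)

-- Induction on the list: the hypothesis replaces the product of the tail by (s / k)^k, and
-- `weightedAMGM` absorbs the new entry.
AMGM : ∀ xs → product xs * length xs ^ length xs ≤ sum xs ^ length xs
AMGM [] = ≤-refl
AMGM (a ∷ xs) = *-cancelʳ-≤ _ _ (k ^ k) {{n^n≢0 k}} (begin
  a * P * suc k ^ suc k * k ^ k
    ≡⟨ regroup a P (suc k ^ suc k) (k ^ k) ⟩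
  suc k ^ suc k * (a * (P * k ^ k))
    ≤⟨ *-monoʳ-≤ (suc k ^ suc k) (*-monoʳ-≤ a (AMGM xs)) ⟩
  suc k ^ suc k * (a * s ^ k)
    ≤⟨ weightedAMGM k s a ⟩
  k ^ k * (s + a) ^ suc k
    ≡⟨ cong (λ t → k ^ k * t ^ suc k) (+-comm s a) ⟩
  k ^ k * (a + s) ^ suc k
    ≡⟨ *-comm (k ^ k) _ ⟩
  (a + s) ^ suc k * k ^ k ∎)
  where
  open ≤-Reasoning
  k = length xs
  P = product xs
  s = sum xs
  regroup : ∀ a P x y → a * P * x * y ≡ x * (a * (P * y))
  regroup = solve-∀

product-replicate : ∀ k x → product (replicate k x) ≡ x ^ k
product-replicate zero x = refl
product-replicate (suc k) x = cong (x *_) (product-replicate k x)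

sum-replicate : ∀ k x → sum (replicate k x) ≡ k * x
sum-replicate zero x = refl
sum-replicate (suc k) x = cong (x +_) (sum-replicate k x)

-- Weighted AM-GM with integer weights, obtained by repeating the entries.
AMGM₂ : ∀ a b x y → x ^ a * y ^ b * (a + b) ^ (a + b) ≤ (a * x + b * y) ^ (a + b)
AMGM₂ a b x y with AMGM (replicate a x ++ replicate b y)
... | ineq rewrite product-++ (replicate a x) (replicate b y)
                 | sum-++ (replicate a x) (replicate b y)
                 | length-++ (replicate a x) {replicate b y}
                 | product-replicate a x | product-replicate b y
                 | sum-replicate a x | sum-replicate b y
                 | length-replicate a {x} | length-replicate b {y} = ineq

-- AM-GM for m copies of 1 + l / m and 2 l copies of 1 / 2, whose mean is 1.
[m+l]^m≤m^m*4^l : ∀ m l .{{_ : NonZero m}} → (m + l) ^ m ≤ m ^ m * 2 ^ (2 * l)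
[m+l]^m≤m^m*4^l m l = *-cancelʳ-≤ _ _ (2 ^ m * m ^ b * K ^ K)
  {{m*n≢0 _ _ {{m*n≢0 _ _ {{m^n≢0 2 m}} {{m^n≢0 m b}}}} {{n^n≢0 K}}}} (begin
  (m + l) ^ m * (2 ^ m * m ^ b * K ^ K)
    ≡⟨ lhs ((m + l) ^ m) (2 ^ m) (m ^ b) (K ^ K) ⟩
  2 ^ m * (m + l) ^ m * m ^ b * K ^ K
    ≡⟨ cong (λ t → t * m ^ b * K ^ K) (^-distribʳ-* 2 (m + l) m) ⟨
  (2 * (m + l)) ^ m * m ^ b * K ^ K
    -- Scaling by 2m turns 1 + l / m and 1 / 2 into the integers 2 (m + l) and m, with mean 2m.
    ≤⟨ AMGM₂ m b (2 * (m + l)) m ⟩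
  (m * (2 * (m + l)) + b * m) ^ K
    ≡⟨ cong (_^ K) (mean m l) ⟩
  (2 * m * K) ^ K
    ≡⟨ ^-distribʳ-* (2 * m) K K ⟩
  (2 * m) ^ K * K ^ K
    ≡⟨ cong (_* K ^ K) (^-distribʳ-* 2 m K) ⟩
  2 ^ K * m ^ K * K ^ K
    ≡⟨ cong₂ (λ s t → s * t * K ^ K) (^-distribˡ-+-* 2 m b) (^-distribˡ-+-* m m b) ⟩
  2 ^ m * 2 ^ b * (m ^ m * m ^ b) * K ^ K
    ≡⟨ rhs (2 ^ m) (2 ^ b) (m ^ m) (m ^ b) (K ^ K) ⟩
  m ^ m * 2 ^ b * (2 ^ m * m ^ b * K ^ K) ∎)
  where
  open ≤-Reasoning
  b = 2 * l
  K = m + b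
  lhs : ∀ a x y z → a * (x * y * z) ≡ x * a * y * z
  lhs = solve-∀
  rhs : ∀ x w a y z → x * w * (a * y) * z ≡ a * w * (x * y * z)
  rhs = solve-∀
  mean : ∀ m l → m * (2 * (m + l)) + (2 * l) * m ≡ 2 * m * (m + 2 * l)
  mean = solve-∀

-- Finite sums and products

module BigOperator {_∙_ : ℕ → ℕ → ℕ} {ε : ℕ} (isCM : IsCommutativeMonoid _≡_ _∙_ ε) where
  open IsCommutativeMonoid isCM using (assoc; identityˡ)
    renaming (isCommutativeSemigroup to isCS)

  commutativeSemigroup : CommutativeSemigroup 0ℓ 0ℓ
  commutativeSemigroup = record { isCommutativeSemigroup = isCS }

  open import Algebra.Properties.CommutativeSemigroup commutativeSemigroup using (interchange)

  -- In this form `∑` and `∏` agree definitionally with `sum` and `product` of a mapped list, so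
  -- `AMGM` and `totalMaxLoad` fit without conversion.
  big : ∀ {A : Set} → List A → (A → ℕ) → ℕ
  big xs f = foldr _∙_ ε (map f xs)

  module _ {A : Set} where

    big-cong : ∀ (xs : List A) {f g} → (∀ x → f x ≡ g x) → big xs f ≡ big xs g
    big-cong [] f≡g = refl
    big-cong (x ∷ xs) f≡g = cong₂ _∙_ (f≡g x) (big-cong xs f≡g)

    big-∙ : ∀ (xs : List A) f g → big xs (λ x → f x ∙ g x) ≡ big xs f ∙ big xs g
    big-∙ [] f g = sym (identityˡ ε)
    big-∙ (x ∷ xs) f g = trans (cong ((f x ∙ g x) ∙_) (big-∙ xs f g)) (interchange (f x) (g x) _ _)

    big-++ : ∀ (xs ys : List A) f → big (xs ++ ys) f ≡ big xs f ∙ big ys f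
    big-++ [] ys f = sym (identityˡ _)
    big-++ (x ∷ xs) ys f = trans (cong (f x ∙_) (big-++ xs ys f)) (sym (assoc _ _ _))

    big-ε : ∀ (xs : List A) → big xs (λ _ → ε) ≡ ε
    big-ε [] = refl
    big-ε (x ∷ xs) = trans (identityˡ _) (big-ε xs)

  module _ {A B : Set} where

    big-map : ∀ (g : A → B) xs f → big (map g xs) f ≡ big xs (f ∘ g)
    big-map g [] f = refl
    big-map g (x ∷ xs) f = cong (f (g x) ∙_) (big-map g xs f)

    big-concatMap : ∀ (g : A → List B) xs f → big (concatMap g xs) f ≡ big xs (λ x → big (g x) f)
    big-concatMap g [] f = refl
    big-concatMap g (x ∷ xs) f =
      trans (big-++ (g x) (concatMap g xs) f) (cong (big (g x) f ∙_) (big-concatMap g xs f))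

    big-swap : ∀ (xs : List A) (ys : List B) (f : A → B → ℕ) →
               big xs (λ x → big ys (f x)) ≡ big ys (λ y → big xs (λ x → f x y))
    big-swap [] ys f = sym (big-ε ys)
    big-swap (x ∷ xs) ys f =
      trans (cong (big ys (f x) ∙_) (big-swap xs ys f)) (sym (big-∙ ys (f x) (λ y → big xs (λ x → f x y))))

  big-allVecsOf : ∀ {A : Set} (xs : List A) k f →
    big (allVecsOf xs (suc k)) f ≡ big xs (λ a → big (allVecsOf xs k) (λ v → f (a ∷ v)))
  big-allVecsOf xs k f = trans
    (big-concatMap (λ a → map (a ∷_) (allVecsOf xs k)) xs f)
    (big-cong xs (λ a → big-map (a ∷_) (allVecsOf xs k) f))

open BigOperator +-0-isCommutativeMonoid using () renaming
  (big to ∑; big-cong to ∑-cong; big-swap to ∑-swap; big-allVecsOf to ∑-allVecsOf)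
open BigOperator *-1-isCommutativeMonoid using () renaming
  (big to ∏; big-cong to ∏-cong; big-∙ to ∏-*; big-swap to ∏-swap; big-allVecsOf to ∏-allVecsOf)

module _ {A : Set} where

  ∑-*ˡ : ∀ (xs : List A) c f → ∑ xs (λ x → c * f x) ≡ c * ∑ xs f
  ∑-*ˡ [] c f = sym (*-zeroʳ c)
  ∑-*ˡ (x ∷ xs) c f = trans (cong (c * f x +_) (∑-*ˡ xs c f)) (sym (*-distribˡ-+ c (f x) _))

  ∑-*ʳ : ∀ (xs : List A) c f → ∑ xs (λ x → f x * c) ≡ ∑ xs f * c
  ∑-*ʳ xs c f = trans (∑-cong xs (λ x → *-comm (f x) c)) (trans (∑-*ˡ xs c f) (*-comm c _))

  ∑-const : ∀ (xs : List A) c → ∑ xs (λ _ → c) ≡ length xs * c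
  ∑-const [] c = refl
  ∑-const (x ∷ xs) c = cong (c +_) (∑-const xs c)

  ∈⇒≤∑ : ∀ {xs : List A} {x} f → x ∈ xs → f x ≤ ∑ xs f
  ∈⇒≤∑ {x ∷ xs} f (here refl) = m≤m+n (f x) _
  ∈⇒≤∑ {y ∷ xs} f (there x∈xs) = ≤-trans (∈⇒≤∑ f x∈xs) (m≤n+m _ (f y))

  ∏-mono-≤ : ∀ (xs : List A) {f g} → (∀ x → f x ≤ g x) → ∏ xs f ≤ ∏ xs g
  ∏-mono-≤ [] f≤g = ≤-refl
  ∏-mono-≤ (x ∷ xs) f≤g = *-mono-≤ (f≤g x) (∏-mono-≤ xs f≤g)

  ∏-const : ∀ (xs : List A) c → ∏ xs (λ _ → c) ≡ c ^ length xs
  ∏-const [] c = refl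
  ∏-const (x ∷ xs) c = cong (c *_) (∏-const xs c)

  ∏-^ˡ : ∀ (xs : List A) f k → ∏ xs (λ x → f x ^ k) ≡ ∏ xs f ^ k
  ∏-^ˡ [] f k = sym (^-zeroˡ k)
  ∏-^ˡ (x ∷ xs) f k = trans (cong (f x ^ k *_) (∏-^ˡ xs f k)) (sym (^-distribʳ-* (f x) _ k))

  -- Turns a product over all h of exponentials of the load into one exponential of the total load.
  ∏-^ʳ : ∀ (xs : List A) b f → ∏ xs (λ x → b ^ f x) ≡ b ^ ∑ xs f
  ∏-^ʳ [] b f = refl
  ∏-^ʳ (x ∷ xs) b f = trans (cong (b ^ f x *_) (∏-^ʳ xs b f)) (sym (^-distribˡ-+-* b (f x) _))

  ∏*n^n≤∑^n : ∀ (xs : List A) f → ∏ xs f * length xs ^ length xs ≤ ∑ xs f ^ length xs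
  ∏*n^n≤∑^n xs f with AMGM (map f xs)
  ... | ineq rewrite length-map f xs = ineq

  -- The member `x₀` excludes the empty list, whose maximum defaults to 0 and is no value of `f`.
  foldr-⊔-attained : ∀ (f : A → ℕ) {xs} {x₀} → x₀ ∈ xs →
                     ∃[ x ] x ∈ xs × foldr _⊔_ 0 (map f xs) ≡ f x
  foldr-⊔-attained f {x ∷ []} _ = x , here refl , ⊔-identityʳ (f x)
  foldr-⊔-attained f {x ∷ xs@(_ ∷ _)} _ with foldr-⊔-attained f {xs} (here refl)
  ... | y , y∈xs , max≡fy with ⊔-sel (f x) (foldr _⊔_ 0 (map f xs))
  ...   | inj₁ max≡fx = x , here refl , max≡fx
  ...   | inj₂ max≡max′ = y , there y∈xs , trans max≡max′ max≡fy

-- Vectors over F₂ and column decomposition of matrices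

infixl 6 _⊕_
_⊕_ : ∀ {k} → F₂^ k → F₂^ k → F₂^ k
_⊕_ = zipWith _xor_

length-allF₂^ : ∀ k → length (allF₂^ k) ≡ 2 ^ k
length-allF₂^ k = trans (sym (*-identityʳ _)) (trans (sym (∑-const (allF₂^ k) 1)) (count k))
  where
  count : ∀ k → ∑ (allF₂^ k) (λ _ → 1) ≡ 2 ^ k
  count zero = refl
  count (suc k) = trans (∑-allVecsOf (false ∷ true ∷ []) k (λ _ → 1))
    (cong (λ t → t + (t + 0)) (count k))

∈-allF₂^ : ∀ k → ∃[ v ] v ∈ allF₂^ k
∈-allF₂^ k with allF₂^ k | length-allF₂^ k
... | v ∷ _ | _ = v , here refl
... | [] | 0≡2^k = ⊥-elim (n≮n 0 (≤-trans (m^n>0 2 k) (≤-reflexive (sym 0≡2^k))))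

-- Translation permutes the group: in each coordinate, adding b either fixes or exchanges the two
-- summands.
∑-translate : ∀ {k} (y : F₂^ k) f → ∑ (allF₂^ k) (λ c → f (c ⊕ y)) ≡ ∑ (allF₂^ k) f
∑-translate [] f = refl
∑-translate {suc k} (b ∷ y) f = begin
  ∑ (allF₂^ (suc k)) (λ c → f (c ⊕ (b ∷ y)))
    ≡⟨ ∑-allVecsOf bits k _ ⟩
  ∑ bits (λ a → ∑ (allF₂^ k) (λ c → f ((a xor b) ∷ c ⊕ y)))
    ≡⟨ ∑-cong bits (λ a → ∑-translate y (λ z → f ((a xor b) ∷ z))) ⟩
  ∑ bits (λ a → ∑ (allF₂^ k) (λ z → f ((a xor b) ∷ z)))
    ≡⟨ flip b (λ a → ∑ (allF₂^ k) (λ z → f (a ∷ z))) ⟩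
  ∑ bits (λ a → ∑ (allF₂^ k) (λ z → f (a ∷ z)))
    ≡⟨ ∑-allVecsOf bits k f ⟨
  ∑ (allF₂^ (suc k)) f ∎
  where
  open ≡-Reasoning
  bits = false ∷ true ∷ []
  exchange : ∀ x y → x + (y + 0) ≡ y + (x + 0)
  exchange = solve-∀
  flip : ∀ b g → ∑ bits (λ a → g (a xor b)) ≡ ∑ bits g
  flip false g = refl
  flip true g = exchange (g true) (g false)

addColumn : ∀ {u ℓ} → F₂^ ℓ → LinMap u ℓ → LinMap (suc u) ℓ
addColumn = zipWith _∷_

-- Matrices are enumerated row by row. By induction on the rows, the first bit of each row is moved
-- inwards past the remaining bits, so that these bits together form the column c.
∏-ℋ-suc : ∀ u ℓ (f : LinMap (suc u) ℓ → ℕ) →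
  ∏ (ℋ (suc u) ℓ) f ≡ ∏ (ℋ u ℓ) (λ h → ∏ (allF₂^ ℓ) (λ c → f (addColumn c h)))
∏-ℋ-suc u zero f = sym (*-identityʳ _)
∏-ℋ-suc u (suc ℓ) f = begin
  ∏ (ℋ (suc u) (suc ℓ)) f
    ≡⟨ ∏-allVecsOf (allF₂^ (suc u)) ℓ f ⟩
  ∏ (allF₂^ (suc u)) (λ r → ∏ (ℋ (suc u) ℓ) (λ h → f (r ∷ h)))
    ≡⟨ ∏-allVecsOf bits u _ ⟩
  ∏ bits (λ b → ∏ (allF₂^ u) (λ r → ∏ (ℋ (suc u) ℓ) (λ h → f ((b ∷ r) ∷ h))))
    ≡⟨ ∏-cong bits (λ b → ∏-cong (allF₂^ u) (λ r → ∏-ℋ-suc u ℓ (λ h → f ((b ∷ r) ∷ h)))) ⟩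
  ∏ bits (λ b → ∏ (allF₂^ u) (λ r → ∏ (ℋ u ℓ) (λ h → ∏ (allF₂^ ℓ) (λ c → f ((b ∷ r) ∷ addColumn c h)))))
    ≡⟨ ∏-swap bits (allF₂^ u) (λ b r → ∏ (ℋ u ℓ) (λ h → ∏ (allF₂^ ℓ) (λ c → f ((b ∷ r) ∷ addColumn c h)))) ⟩
  ∏ (allF₂^ u) (λ r → ∏ bits (λ b → ∏ (ℋ u ℓ) (λ h → ∏ (allF₂^ ℓ) (λ c → f ((b ∷ r) ∷ addColumn c h)))))
    ≡⟨ ∏-cong (allF₂^ u) (λ r → ∏-swap bits (ℋ u ℓ) (λ b h → ∏ (allF₂^ ℓ) (λ c → f ((b ∷ r) ∷ addColumn c h)))) ⟩
  ∏ (allF₂^ u) (λ r → ∏ (ℋ u ℓ) (λ h → ∏ bits (λ b → ∏ (allF₂^ ℓ) (λ c → f ((b ∷ r) ∷ addColumn c h)))))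
    ≡⟨ ∏-cong (allF₂^ u) (λ r → ∏-cong (ℋ u ℓ) (λ h →
         ∏-allVecsOf bits ℓ (λ c → f (addColumn c (r ∷ h))))) ⟨
  ∏ (allF₂^ u) (λ r → ∏ (ℋ u ℓ) (λ h → ∏ (allF₂^ (suc ℓ)) (λ c → f (addColumn c (r ∷ h)))))
    ≡⟨ ∏-allVecsOf (allF₂^ u) ℓ _ ⟨
  ∏ (ℋ u (suc ℓ)) (λ h → ∏ (allF₂^ (suc ℓ)) (λ c → f (addColumn c h))) ∎
  where
  open ≡-Reasoning
  bits = false ∷ true ∷ []

apply-addColumn-false : ∀ {u ℓ} (c : F₂^ ℓ) (h : LinMap u ℓ) x →
                        apply (addColumn c h) (false ∷ x) ≡ apply h x
apply-addColumn-false [] [] x = refl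
apply-addColumn-false (b ∷ c) (r ∷ h) x =
  cong₂ _∷_ (cong (_xor dot r x) (∧-zeroʳ b)) (apply-addColumn-false c h x)

apply-addColumn-true : ∀ {u ℓ} (c : F₂^ ℓ) (h : LinMap u ℓ) x →
                       apply (addColumn c h) (true ∷ x) ≡ c ⊕ apply h x
apply-addColumn-true [] [] x = refl
apply-addColumn-true (b ∷ c) (r ∷ h) x =
  cong₂ _∷_ (cong (_xor dot r x) (∧-identityʳ b)) (apply-addColumn-true c h x)

-- Splitting a point set by its first coordinate

tailsOf : ∀ {u} → Bool → List (F₂^ (suc u)) → List (F₂^ u)
tailsOf b [] = []
tailsOf false ((false ∷ x) ∷ S) = x ∷ tailsOf false S
tailsOf false ((true ∷ x) ∷ S) = tailsOf false S
tailsOf true ((false ∷ x) ∷ S) = tailsOf true S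
tailsOf true ((true ∷ x) ∷ S) = x ∷ tailsOf true S

tailsOf-All-≢ : ∀ {u} b {x : F₂^ u} S → All ((b ∷ x) ≢_) S → All (x ≢_) (tailsOf b S)
tailsOf-All-≢ b [] [] = []
tailsOf-All-≢ false ((false ∷ y) ∷ S) (≢y ∷ ≢S) = (≢y ∘ cong (false ∷_)) ∷ tailsOf-All-≢ false S ≢S
tailsOf-All-≢ false ((true ∷ y) ∷ S) (≢y ∷ ≢S) = tailsOf-All-≢ false S ≢S
tailsOf-All-≢ true ((false ∷ y) ∷ S) (≢y ∷ ≢S) = tailsOf-All-≢ true S ≢S
tailsOf-All-≢ true ((true ∷ y) ∷ S) (≢y ∷ ≢S) = (≢y ∘ cong (true ∷_)) ∷ tailsOf-All-≢ true S ≢S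

tailsOf-Unique : ∀ {u} b (S : List (F₂^ (suc u))) → Unique S → Unique (tailsOf b S)
tailsOf-Unique b [] [] = []
tailsOf-Unique false ((false ∷ x) ∷ S) (≢S ∷ uS) = tailsOf-All-≢ false S ≢S ∷ tailsOf-Unique false S uS
tailsOf-Unique false ((true ∷ x) ∷ S) (_ ∷ uS) = tailsOf-Unique false S uS
tailsOf-Unique true ((false ∷ x) ∷ S) (_ ∷ uS) = tailsOf-Unique true S uS
tailsOf-Unique true ((true ∷ x) ∷ S) (≢S ∷ uS) = tailsOf-All-≢ true S ≢S ∷ tailsOf-Unique true S uS

length-tailsOf : ∀ {u} (S : List (F₂^ (suc u))) →
                 length S ≡ length (tailsOf false S) + length (tailsOf true S)
length-tailsOf [] = refl
length-tailsOf ((false ∷ x) ∷ S) = cong suc (length-tailsOf S)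
length-tailsOf ((true ∷ x) ∷ S) = trans (cong suc (length-tailsOf S)) (sym (+-suc _ _))

-- The potential

-- Each point x contributes the factor p at y = h x and q elsewhere: p / q is the base of the
-- exponential moment of the load.
module Potential (p q : ℕ) where

  weight : ∀ {k} → F₂^ k → F₂^ k → ℕ
  weight z y = if does (z ≟v y) then p else q

  -- In characteristic 2, c ⊕ z = y is equivalent to z = c ⊕ y.
  weight-⊕ : ∀ {k} (c z y : F₂^ k) → weight (c ⊕ z) y ≡ weight z (c ⊕ y)
  weight-⊕ [] [] [] = refl
  weight-⊕ (false ∷ c) (false ∷ z) (false ∷ y) = weight-⊕ c z y
  weight-⊕ (false ∷ c) (false ∷ z) (true ∷ y) = refl
  weight-⊕ (false ∷ c) (true ∷ z) (false ∷ y) = refl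
  weight-⊕ (false ∷ c) (true ∷ z) (true ∷ y) = weight-⊕ c z y
  weight-⊕ (true ∷ c) (false ∷ z) (false ∷ y) = refl
  weight-⊕ (true ∷ c) (false ∷ z) (true ∷ y) = weight-⊕ c z y
  weight-⊕ (true ∷ c) (true ∷ z) (false ∷ y) = weight-⊕ c z y
  weight-⊕ (true ∷ c) (true ∷ z) (true ∷ y) = refl

  -- The exact value is p + (2^k - 1) q; the relaxed bound avoids subtraction.
  ∑-weight : ∀ {k} (z : F₂^ k) → ∑ (allF₂^ k) (weight z) ≤ p + 2 ^ k * q
  ∑-weight [] = +-monoʳ-≤ p z≤n
  ∑-weight {suc k} (b ∷ z) = begin
    ∑ (allF₂^ (suc k)) (weight (b ∷ z))
      ≡⟨ ∑-allVecsOf (false ∷ true ∷ []) k (weight (b ∷ z)) ⟩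
    ∑ (false ∷ true ∷ []) (λ a → ∑ (allF₂^ k) (λ y → weight (b ∷ z) (a ∷ y)))
      -- On the half whose first bit differs from b, every weight is q.
      ≡⟨ halves b ⟩
    ∑ (allF₂^ k) (weight z) + ∑ (allF₂^ k) (λ _ → q)
      ≤⟨ +-mono-≤ (∑-weight z) (≤-reflexive (∑-const (allF₂^ k) q)) ⟩
    p + 2 ^ k * q + length (allF₂^ k) * q
      ≡⟨ cong (λ t → p + 2 ^ k * q + t * q) (length-allF₂^ k) ⟩
    p + 2 ^ k * q + 2 ^ k * q
      ≡⟨ double p (2 ^ k) q ⟩
    p + 2 * 2 ^ k * q ∎
    where
    open ≤-Reasoning
    double : ∀ p n q → p + n * q + n * q ≡ p + 2 * n * q
    double = solve-∀
    halves : ∀ b → ∑ (false ∷ true ∷ []) (λ a → ∑ (allF₂^ k) (λ y → weight (b ∷ z) (a ∷ y)))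
                 ≡ ∑ (allF₂^ k) (weight z) + ∑ (allF₂^ k) (λ _ → q)
    halves false = cong (∑ (allF₂^ k) (weight z) +_) (+-identityʳ _)
    halves true = trans (cong (∑ (allF₂^ k) (λ _ → q) +_) (+-identityʳ _)) (+-comm (∑ (allF₂^ k) (λ _ → q)) _)

  -- If k of the m points of S are sent to y, this is p^k q^(m-k). For nonzero q, `potential` is
  -- therefore q^m W(h, S) with λ = p / q.
  moment : ∀ {u ℓ} → LinMap u ℓ → List (F₂^ u) → F₂^ ℓ → ℕ
  moment h S y = ∏ S (λ x → weight (apply h x) y)

  potential : ∀ {u ℓ} → LinMap u ℓ → List (F₂^ u) → ℕ
  potential {ℓ = ℓ} h S = ∑ (allF₂^ ℓ) (moment h S)

  -- The factor q^k on the right stands in for the exponent m - k, avoiding truncated subtraction.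
  moment-load : ∀ {u ℓ} (h : LinMap u ℓ) S y →
    p ^ preimageCount h S y * q ^ length S ≡ q ^ preimageCount h S y * moment h S y
  moment-load h [] y = refl
  moment-load h (x ∷ S) y with apply h x ≟v y
  ... | yes _ = trans (left p (p ^ k) q (q ^ length S))
                  (trans (cong (p * q *_) (moment-load h S y)) (right p q (q ^ k) _))
    where
    k = preimageCount h S y
    left : ∀ p P q Q → p * P * (q * Q) ≡ p * q * (P * Q)
    left = solve-∀
    right : ∀ p q K M → p * q * (K * M) ≡ q * K * (p * M)
    right = solve-∀
  ... | no _ = trans (left (p ^ k) q (q ^ length S))
                 (trans (cong (q *_) (moment-load h S y)) (right q (q ^ k) _))
    where
    k = preimageCount h S y
    left : ∀ P q Q → P * (q * Q) ≡ q * (P * Q)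
    left = solve-∀
    right : ∀ q K M → q * (K * M) ≡ K * (q * M)
    right = solve-∀

  -- This is λ^maxload ≤ W: the moment at a y of maximal load is one summand of the potential.
  maxLoad-potential : ∀ {u ℓ} (h : LinMap u ℓ) S →
    p ^ maxLoad h S * q ^ length S ≤ q ^ maxLoad h S * potential h S
  maxLoad-potential {ℓ = ℓ} h S with ∈-allF₂^ ℓ
  ... | _ , v∈V with foldr-⊔-attained (preimageCount h S) v∈V
  ...   | y , y∈V , max≡load rewrite max≡load =
    ≤-trans (≤-reflexive (moment-load h S y)) (*-monoʳ-≤ (q ^ preimageCount h S y) (∈⇒≤∑ (moment h S) y∈V))

  -- A first bit 0 leaves the hash value alone, a first bit 1 shifts it by c; `weight-⊕` moves the
  -- shift onto y.
  moment-addColumn : ∀ {u ℓ} (c : F₂^ ℓ) (h : LinMap u ℓ) S y →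
    moment (addColumn c h) S y ≡ moment h (tailsOf false S) y * moment h (tailsOf true S) (c ⊕ y)
  moment-addColumn c h [] y = refl
  moment-addColumn c h ((false ∷ x) ∷ S) y = trans
    (cong₂ _*_ (cong (λ z → weight z y) (apply-addColumn-false c h x)) (moment-addColumn c h S y))
    (sym (*-assoc (weight (apply h x) y) _ _))
  moment-addColumn c h ((true ∷ x) ∷ S) y = trans
    (cong₂ _*_ (trans (cong (λ z → weight z y) (apply-addColumn-true c h x)) (weight-⊕ c (apply h x) y))
               (moment-addColumn c h S y))
    (shuffle (weight (apply h x) (c ⊕ y)) (moment h (tailsOf false S) y) _)
    where
    shuffle : ∀ w a b → w * (a * b) ≡ a * (w * b)
    shuffle = solve-∀

  -- For fixed y, c ⊕ y runs over the whole space along with c, so the inner sum no longer depends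
  -- on y and factors out.
  ∑-potential-addColumn : ∀ {u ℓ} (h : LinMap u ℓ) S →
    ∑ (allF₂^ ℓ) (λ c → potential (addColumn c h) S)
      ≡ potential h (tailsOf false S) * potential h (tailsOf true S)
  ∑-potential-addColumn {ℓ = ℓ} h S = begin
    ∑ V (λ c → ∑ V (moment (addColumn c h) S))
      ≡⟨ ∑-cong V (λ c → ∑-cong V (moment-addColumn c h S)) ⟩
    ∑ V (λ c → ∑ V (λ y → moment h S₀ y * moment h S₁ (c ⊕ y)))
      ≡⟨ ∑-swap V V (λ c y → moment h S₀ y * moment h S₁ (c ⊕ y)) ⟩
    ∑ V (λ y → ∑ V (λ c → moment h S₀ y * moment h S₁ (c ⊕ y)))
      ≡⟨ ∑-cong V (λ y → ∑-*ˡ V (moment h S₀ y) _) ⟩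
    ∑ V (λ y → moment h S₀ y * ∑ V (λ c → moment h S₁ (c ⊕ y)))
      ≡⟨ ∑-cong V (λ y → cong (moment h S₀ y *_) (∑-translate y (moment h S₁))) ⟩
    ∑ V (λ y → moment h S₀ y * potential h S₁)
      ≡⟨ ∑-*ʳ V (potential h S₁) (moment h S₀) ⟩
    potential h S₀ * potential h S₁ ∎
    where
    open ≡-Reasoning
    V = allF₂^ ℓ
    S₀ = tailsOf false S
    S₁ = tailsOf true S

  -- The Jensen step: AM-GM over the n choices of c.
  ∏-potential-addColumn : ∀ {u ℓ} (h : LinMap u ℓ) S → let n = 2 ^ ℓ in
    ∏ (allF₂^ ℓ) (λ c → potential (addColumn c h) S) * n ^ n
      ≤ (potential h (tailsOf false S) * potential h (tailsOf true S)) ^ n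
  ∏-potential-addColumn {ℓ = ℓ} h S with ∏*n^n≤∑^n (allF₂^ ℓ) (λ c → potential (addColumn c h) S)
  ... | ineq rewrite length-allF₂^ ℓ | ∑-potential-addColumn h S = ineq

  -- The factors nᵐ and n Dᵐ are constant, and kept under the product so that |ℋ| never has to be
  -- computed.
  ∏-potential : ∀ u ℓ (S : List (F₂^ u)) → Unique S → let n = 2 ^ ℓ in
    ∏ (ℋ u ℓ) (λ h → potential h S * n ^ length S)
      ≤ ∏ (ℋ u ℓ) (λ _ → n * (p + n * q) ^ length S)
  ∏-potential zero ℓ [] _ = ∏-mono-≤ (ℋ 0 ℓ) (λ h → ≤-reflexive (cong (_* 1)
    (trans (∑-const (allF₂^ ℓ) 1) (trans (*-identityʳ _) (length-allF₂^ ℓ)))))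
  -- For a single point the potential is a sum of weights, hence at most p + n q.
  ∏-potential zero ℓ ([] ∷ []) _ = ∏-mono-≤ (ℋ 0 ℓ) (λ h → begin
    ∑ (allF₂^ ℓ) (λ y → weight (apply h []) y * 1) * (n * 1)
      ≡⟨ cong₂ _*_ (∑-cong (allF₂^ ℓ) (λ y → *-identityʳ (weight (apply h []) y))) (*-identityʳ n) ⟩
    ∑ (allF₂^ ℓ) (weight (apply h [])) * n
      ≤⟨ *-monoˡ-≤ n (∑-weight (apply h [])) ⟩
    (p + n * q) * n
      ≡⟨ *-comm (p + n * q) n ⟩
    n * (p + n * q)
      ≡⟨ cong (n *_) (*-identityʳ (p + n * q)) ⟨
    n * ((p + n * q) * 1) ∎)
    where
    open ≤-Reasoning
    n = 2 ^ ℓ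
  -- The space F₂^0 has one point, so a second entry would be a repetition.
  ∏-potential zero ℓ ([] ∷ [] ∷ S) ((≢[] ∷ _) ∷ _) = ⊥-elim (≢[] refl)
  ∏-potential (suc u) ℓ S uniq = *-cancelʳ-≤ _ _ (∏ H (λ _ → n ^ n)) {{∏n^n≢0}} (begin
    ∏ (ℋ (suc u) ℓ) (λ h → potential h S * n ^ m) * ∏ H (λ _ → n ^ n)
      ≡⟨ cong (_* ∏ H (λ _ → n ^ n)) (∏-ℋ-suc u ℓ _) ⟩
    ∏ H (λ h → ∏ V (λ c → potential (addColumn c h) S * n ^ m)) * ∏ H (λ _ → n ^ n)
      ≡⟨ ∏-* H _ _ ⟨
    ∏ H (λ h → ∏ V (λ c → potential (addColumn c h) S * n ^ m) * n ^ n)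
      ≤⟨ ∏-mono-≤ H step ⟩
    ∏ H (λ h → (a₀ h * a₁ h) ^ n)
      ≡⟨ trans (∏-^ˡ H _ n) (cong (_^ n) (∏-* H a₀ a₁)) ⟩
    (∏ H a₀ * ∏ H a₁) ^ n
      ≤⟨ ^-monoˡ-≤ n (*-mono-≤ (∏-potential u ℓ S₀ (tailsOf-Unique false S uniq))
                               (∏-potential u ℓ S₁ (tailsOf-Unique true S uniq))) ⟩
    (∏ H (λ _ → n * D ^ m₀) * ∏ H (λ _ → n * D ^ m₁)) ^ n
      ≡⟨ trans (cong (_^ n) (sym (∏-* H _ _))) (sym (∏-^ˡ H _ n)) ⟩
    ∏ H (λ _ → (n * D ^ m₀ * (n * D ^ m₁)) ^ n)
      -- Each half brings a factor n where the target has only one. The surplus, raised to the n-th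
      -- power, is exactly the n^n that AM-GM put on the left.
      ≡⟨ ∏-cong H (λ _ → collect) ⟩
    ∏ H (λ _ → ∏ V (λ _ → n * D ^ m) * n ^ n)
      ≡⟨ ∏-* H _ _ ⟩
    ∏ H (λ _ → ∏ V (λ _ → n * D ^ m)) * ∏ H (λ _ → n ^ n)
      ≡⟨ cong (_* ∏ H (λ _ → n ^ n)) (∏-ℋ-suc u ℓ _) ⟨
    ∏ (ℋ (suc u) ℓ) (λ _ → n * D ^ m) * ∏ H (λ _ → n ^ n) ∎)
    where
    open ≤-Reasoning
    n = 2 ^ ℓ
    D = p + n * q
    m = length S
    H = ℋ u ℓ
    V = allF₂^ ℓ
    S₀ = tailsOf false S
    S₁ = tailsOf true S
    m₀ = length S₀
    m₁ = length S₁
    a₀ a₁ : LinMap u ℓ → ℕ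
    a₀ h = potential h S₀ * n ^ m₀
    a₁ h = potential h S₁ * n ^ m₁

    ∏n^n≢0 : NonZero (∏ H (λ _ → n ^ n))
    ∏n^n≢0 rewrite ∏-const H (n ^ n) = m^n≢0 (n ^ n) (length H) {{n^n≢0 n}}

    ^m-split : ∀ b → b ^ m ≡ b ^ m₀ * b ^ m₁
    ^m-split b = trans (cong (b ^_) (length-tailsOf S)) (^-distribˡ-+-* b m₀ m₁)

    ∏V-const : ∀ c → ∏ V (λ _ → c) ≡ c ^ n
    ∏V-const c = trans (∏-const V c) (cong (c ^_) (length-allF₂^ ℓ))

    swapʳ : ∀ x y z → x * y * z ≡ x * z * y
    swapʳ = solve-∀
    pair : ∀ x y a b → x * y * (a * b) ≡ x * a * (y * b)
    pair = solve-∀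
    pull : ∀ n x y → n * x * (n * y) ≡ n * (x * y) * n
    pull = solve-∀

    step : ∀ h → ∏ V (λ c → potential (addColumn c h) S * n ^ m) * n ^ n ≤ (a₀ h * a₁ h) ^ n
    step h = begin
      ∏ V (λ c → potential (addColumn c h) S * n ^ m) * n ^ n
        ≡⟨ cong (_* n ^ n) (trans (∏-* V (λ c → potential (addColumn c h) S) _) (cong (W *_) (∏V-const (n ^ m)))) ⟩
      W * (n ^ m) ^ n * n ^ n
        ≡⟨ swapʳ W ((n ^ m) ^ n) (n ^ n) ⟩
      W * n ^ n * (n ^ m) ^ n
        ≤⟨ *-monoˡ-≤ ((n ^ m) ^ n) (∏-potential-addColumn h S) ⟩
      (potential h S₀ * potential h S₁) ^ n * (n ^ m) ^ n
        ≡⟨ ^-distribʳ-* (potential h S₀ * potential h S₁) (n ^ m) n ⟨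
      (potential h S₀ * potential h S₁ * n ^ m) ^ n
        ≡⟨ cong (λ t → (potential h S₀ * potential h S₁ * t) ^ n) (^m-split n) ⟩
      (potential h S₀ * potential h S₁ * (n ^ m₀ * n ^ m₁)) ^ n
        ≡⟨ cong (_^ n) (pair (potential h S₀) (potential h S₁) (n ^ m₀) (n ^ m₁)) ⟩
      (a₀ h * a₁ h) ^ n ∎
      where W = ∏ V (λ c → potential (addColumn c h) S)

    collect : (n * D ^ m₀ * (n * D ^ m₁)) ^ n ≡ ∏ V (λ _ → n * D ^ m) * n ^ n
    collect = begin-equality
      (n * D ^ m₀ * (n * D ^ m₁)) ^ n   ≡⟨ cong (_^ n) (pull n (D ^ m₀) (D ^ m₁)) ⟩
      (n * (D ^ m₀ * D ^ m₁) * n) ^ n   ≡⟨ cong (λ t → (n * t * n) ^ n) (^m-split D) ⟨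
      (n * D ^ m * n) ^ n               ≡⟨ ^-distribʳ-* (n * D ^ m) n n ⟩
      (n * D ^ m) ^ n * n ^ n           ≡⟨ cong (_* n ^ n) (∏V-const (n * D ^ m)) ⟨
      ∏ V (λ _ → n * D ^ m) * n ^ n     ∎

  -- For nonzero q, dividing and taking N-th roots gives λ^(A/N) ≤ n (1 + λ/n)^m with λ = p / q. It
  -- is the product over all h of λ^maxload ≤ W, combined with `∏-potential`.
  totalMaxLoad-bound : ∀ u ℓ (S : List (F₂^ u)) → Unique S →
    let n = 2 ^ ℓ ; m = length S ; A = totalMaxLoad u ℓ S ; N = length (ℋ u ℓ) in
    p ^ A * (q ^ m * n ^ m) ^ N ≤ q ^ A * (n * (p + n * q) ^ m) ^ N
  totalMaxLoad-bound u ℓ S uniq = begin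
    p ^ A * (q ^ m * n ^ m) ^ N
      ≡⟨ cong₂ _*_ (∏-^ʳ H p load) (∏-const H (q ^ m * n ^ m)) ⟨
    ∏ H (λ h → p ^ load h) * ∏ H (λ _ → q ^ m * n ^ m)
      ≡⟨ ∏-* H _ _ ⟨
    ∏ H (λ h → p ^ load h * (q ^ m * n ^ m))
      ≤⟨ ∏-mono-≤ H pointwise ⟩
    ∏ H (λ h → q ^ load h * (potential h S * n ^ m))
      ≡⟨ ∏-* H _ _ ⟩
    ∏ H (λ h → q ^ load h) * ∏ H (λ h → potential h S * n ^ m)
      ≤⟨ *-monoʳ-≤ (∏ H (λ h → q ^ load h)) (∏-potential u ℓ S uniq) ⟩
    ∏ H (λ h → q ^ load h) * ∏ H (λ _ → n * (p + n * q) ^ m)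
      ≡⟨ cong₂ _*_ (∏-^ʳ H q load) (∏-const H (n * (p + n * q) ^ m)) ⟩
    q ^ A * (n * (p + n * q) ^ m) ^ N ∎
    where
    open ≤-Reasoning
    n = 2 ^ ℓ
    m = length S
    H = ℋ u ℓ
    N = length H
    A = totalMaxLoad u ℓ S
    load : LinMap u ℓ → ℕ
    load h = maxLoad h S
    pointwise : ∀ h → p ^ load h * (q ^ m * n ^ m) ≤ q ^ load h * (potential h S * n ^ m)
    pointwise h = begin
      p ^ load h * (q ^ m * n ^ m)           ≡⟨ *-assoc (p ^ load h) _ _ ⟨
      p ^ load h * q ^ m * n ^ m             ≤⟨ *-monoˡ-≤ (n ^ m) (maxLoad-potential h S) ⟩
      q ^ load h * potential h S * n ^ m     ≡⟨ *-assoc (q ^ load h) _ _ ⟩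
      q ^ load h * (potential h S * n ^ m)   ∎

-- The sparse and dense cases

open Potential using (totalMaxLoad-bound)

theorem1p2 : (u ℓ m : ℕ) → 1 ≤ ℓ → ℓ ≤ u → 1 ≤ m → m ≤ 2 ^ u
    → (S : List (F₂^ u)) → Unique S → length S ≡ m
    → AvgLe16Opt m ℓ (totalMaxLoad u ℓ S) (length (ℋ u ℓ))
theorem1p2 u ℓ m 1≤ℓ ℓ≤u 1≤m m≤2^u S uniq refl = sparse , dense
  where
  open ≤-Reasoning
  n = 2 ^ ℓ
  N = length (ℋ u ℓ)
  A = totalMaxLoad u ℓ S
  instance
    n≢0 : NonZero n
    n≢0 = m^n≢0 2 ℓ
    m≢0 : NonZero m
    m≢0 = >-nonZero 1≤m

  -- p / q = ℓ n / m, so that D = p + n q = n (m + ℓ).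
  sparse : 2 * m ≤ ℓ * n → (ℓ * n) ^ A ≤ m ^ A * 2 ^ (16 * ℓ * N)
  sparse _ = *-cancelʳ-≤ _ _ (B ^ N)
    {{m^n≢0 B N {{m*n≢0 (m ^ m) (n ^ m) {{m^n≢0 m m}} {{m^n≢0 n m}}}}}} (begin
    (ℓ * n) ^ A * B ^ N
      ≤⟨ totalMaxLoad-bound (ℓ * n) m u ℓ S uniq ⟩
    m ^ A * (n * (ℓ * n + n * m) ^ m) ^ N
      ≤⟨ *-monoʳ-≤ (m ^ A) (^-monoˡ-≤ N base) ⟩
    m ^ A * (2 ^ (3 * ℓ) * B) ^ N
      ≡⟨ cong (m ^ A *_) (trans (^-distribʳ-* (2 ^ (3 * ℓ)) B N) (cong (_* B ^ N) (^-*-assoc 2 (3 * ℓ) N))) ⟩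
    m ^ A * (2 ^ (3 * ℓ * N) * B ^ N)
      -- The argument yields the constant 3, and 3 + 13 = 16.
      ≤⟨ *-monoʳ-≤ (m ^ A) (*-monoˡ-≤ (B ^ N) (^-monoʳ-≤ 2 (*-monoˡ-≤ N (*-monoˡ-≤ ℓ (m≤m+n 3 13))))) ⟩
    m ^ A * (2 ^ (16 * ℓ * N) * B ^ N)
      ≡⟨ *-assoc (m ^ A) _ _ ⟨
    m ^ A * 2 ^ (16 * ℓ * N) * B ^ N ∎)
    where
    B = m ^ m * n ^ m
    factor : ∀ ℓ n m → ℓ * n + n * m ≡ n * (m + ℓ)
    factor = solve-∀
    regroup : ∀ n x y z → n * (x * (y * z)) ≡ n * z * (y * x)
    regroup = solve-∀
    base : n * (ℓ * n + n * m) ^ m ≤ 2 ^ (3 * ℓ) * B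
    base = begin
      n * (ℓ * n + n * m) ^ m           ≡⟨ cong (λ t → n * t ^ m) (factor ℓ n m) ⟩
      n * (n * (m + ℓ)) ^ m             ≡⟨ cong (n *_) (^-distribʳ-* n (m + ℓ) m) ⟩
      -- (1 + ℓ/m)^m costs 2ℓ in the exponent of 2 and the leading n costs ℓ, together 3ℓ.
      n * (n ^ m * (m + ℓ) ^ m)         ≤⟨ *-monoʳ-≤ n (*-monoʳ-≤ (n ^ m) ([m+l]^m≤m^m*4^l m ℓ)) ⟩
      n * (n ^ m * (m ^ m * 2 ^ (2 * ℓ)))  ≡⟨ regroup n (n ^ m) (m ^ m) (2 ^ (2 * ℓ)) ⟩
      n * 2 ^ (2 * ℓ) * B               ≡⟨ cong (_* B) (^-distribˡ-+-* 2 ℓ (2 * ℓ)) ⟨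
      2 ^ (3 * ℓ) * B                   ∎

  -- p / q = 2, so that D = n + 2; the n-th power turns (1 + 2 / n)ⁿ into a constant.
  dense : ℓ * n < 2 * m → A * n ≤ 16 * m * N
  dense ℓn<2m = ≤-trans (^-cancelʳ-≤ 2 (s≤s (s≤s z≤n)) (*-cancelʳ-≤ _ _ (B ^ N)
    {{m^n≢0 B N {{m^n≢0 (n ^ n) m {{n^n≢0 n}}}}}} (begin
    2 ^ (A * n) * B ^ N
      ≡⟨ cong₂ _*_ (sym (^-*-assoc 2 A n)) (trans (cong (_^ N) (^-comm n n m)) (^-comm (n ^ m) n N)) ⟩
    (2 ^ A) ^ n * ((n ^ m) ^ N) ^ n
      ≡⟨ ^-distribʳ-* (2 ^ A) ((n ^ m) ^ N) n ⟨
    (2 ^ A * (n ^ m) ^ N) ^ n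
      ≤⟨ ^-monoˡ-≤ n bound ⟩
    ((n * (n + 2) ^ m) ^ N) ^ n
      ≡⟨ ^-comm (n * (n + 2) ^ m) N n ⟩
    ((n * (n + 2) ^ m) ^ n) ^ N
      ≤⟨ ^-monoˡ-≤ N base ⟩
    (2 ^ (6 * m) * B) ^ N
      ≡⟨ trans (^-distribʳ-* (2 ^ (6 * m)) B N) (cong (_* B ^ N) (^-*-assoc 2 (6 * m) N)) ⟩
    -- Comparing exponents of 2 gives A n ≤ 6 m N, and 6 + 10 = 16.
    2 ^ (6 * m * N) * B ^ N ∎))) (*-monoˡ-≤ N (*-monoˡ-≤ m (m≤m+n 6 10)))
    where
    B = (n ^ n) ^ m
    ^-comm : ∀ x a b → (x ^ a) ^ b ≡ (x ^ b) ^ a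
    ^-comm x a b = trans (^-*-assoc x a b) (trans (cong (x ^_) (*-comm a b)) (sym (^-*-assoc x b a)))

    bound : 2 ^ A * (n ^ m) ^ N ≤ (n * (n + 2) ^ m) ^ N
    bound = begin
      2 ^ A * (n ^ m) ^ N
        ≡⟨ cong (λ t → 2 ^ A * t ^ N) (trans (cong (_* n ^ m) (^-zeroˡ m)) (*-identityˡ (n ^ m))) ⟨
      2 ^ A * (1 ^ m * n ^ m) ^ N
        ≤⟨ totalMaxLoad-bound 2 1 u ℓ S uniq ⟩
      1 ^ A * (n * (2 + n * 1) ^ m) ^ N
        ≡⟨ trans (cong (_* (n * (2 + n * 1) ^ m) ^ N) (^-zeroˡ A)) (*-identityˡ _) ⟩
      (n * (2 + n * 1) ^ m) ^ N
        ≡⟨ cong (λ t → (n * t ^ m) ^ N) (trans (cong (2 +_) (*-identityʳ n)) (+-comm 2 n)) ⟩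
      (n * (n + 2) ^ m) ^ N ∎

    base : (n * (n + 2) ^ m) ^ n ≤ 2 ^ (6 * m) * B
    base = begin
      (n * (n + 2) ^ m) ^ n
        ≡⟨ ^-distribʳ-* n ((n + 2) ^ m) n ⟩
      n ^ n * ((n + 2) ^ m) ^ n
        ≡⟨ cong₂ _*_ (^-*-assoc 2 ℓ n) (^-comm (n + 2) m n) ⟩
      2 ^ (ℓ * n) * ((n + 2) ^ n) ^ m
        -- Density bounds n^n = 2^(ℓn) by 2^(2m), and (1 + 2/n)^n ≤ 2^4 contributes 4m, for a total
        -- exponent of 6m.
        ≤⟨ *-mono-≤ (^-monoʳ-≤ 2 (<⇒≤ ℓn<2m)) (^-monoˡ-≤ m ([m+l]^m≤m^m*4^l n 2)) ⟩
      2 ^ (2 * m) * (n ^ n * 2 ^ 4) ^ m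
        ≡⟨ cong (2 ^ (2 * m) *_) (trans (^-distribʳ-* (n ^ n) (2 ^ 4) m) (cong (B *_) (^-*-assoc 2 4 m))) ⟩
      2 ^ (2 * m) * (B * 2 ^ (4 * m))
        ≡⟨ regroup (2 ^ (2 * m)) B (2 ^ (4 * m)) ⟩
      2 ^ (2 * m) * 2 ^ (4 * m) * B
        ≡⟨ cong (_* B) (trans (sym (^-distribˡ-+-* 2 (2 * m) (4 * m))) (cong (2 ^_) (sym (*-distribʳ-+ m 2 4)))) ⟩
      2 ^ (6 * m) * B ∎
      where
      regroup : ∀ x y z → x * (y * z) ≡ x * z * y
      regroup = solve-∀
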